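{- For all nonnegative integers $n$ and $k$, $$ s(-n,k)=\frac{(-1)^k}{n!}\sum_{\substack{\rho\in\mathcal P\\ \ell(\rho)=k\\ \rho_1\le n}}\pi(\rho)^{ -1}, $$ where the sum is over all linear partitions $\rho$ with exactly $k$ parts and with no part greater than $n$.
   Context: For a nonnegative integer $n$, $(y)_{ -n}=\frac{1}{(y+1)(y+2)\cdots(y+n)}$ (with $(y)_0=1$), and the Stirling number of the first kind $s(-n,k)$ of degree $-n$ and order $k\ge 0$ is the coefficient of $y^k$ in the Taylor expansion of $(y)_{ -n}$ at $y=0$. A linear partition is a nonincreasing infinite sequence $\rho=(\rho_i)_{i\ge1}$ of nonnegative integers that is eventually zero; $\mathcal P$ is the set of all linear partitions. The nonzero $\rho_i$ are the parts of $\rho$ (counted with multiplicity), $\ell(\rho)$ is the number of parts, and $\pi(\rho)$ is the product of the parts. The zero sequence is a linear partition with no parts, and the product of its parts is $1$. -}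

module Defs where

open import Data.Fin.Base using (zero; suc; toℕ)
import Data.Integer.Base as ℤ
open import Data.List.Base using (List; applyUpTo; filter; foldr; length; map)
open import Data.List.Relation.Unary.All.Properties using (all-filter)
open import Data.Nat.Base as ℕ using (ℕ; zero; suc; _∸_; _≤_)
open import Data.Nat.ListAction using (product)
open import Data.Nat.ListAction.Properties using (product≢0)
open import Data.Nat.Properties using (nonZero?)
open import Data.Product.Base using (Σ-syntax; ∃-syntax; _×_; proj₁)
open import Data.Rational.Base hiding (_≤_)
open import Data.Rational.Properties using
  (+-0-commutativeMonoid; +-identityʳ; +-inverseˡ; *-assoc; *-identityˡ; *-inverseʳ;
   neg-distribʳ-*; normalize-pos; pos*pos⇒pos; pos⇒nonZero)
open import Data.Vec.Base using (Vec; []; _∷_; head; lookup)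
open import Algebra.Properties.CommutativeMonoid.Sum +-0-commutativeMonoid
  using (sum; sum-cong-≗)
open import Function.Base using (_∘_; _on_)
open import Level using (0ℓ)
open import Relation.Binary.Bundles using (Setoid)
import Relation.Binary.Construct.On as On
open import Relation.Binary.PropositionalEquality

-- Formal power series in y over ℚ; `a k` is the coefficient of yᵏ.

Series : Set
Series = ℕ → ℚ

one : Series
one zero    = 1ℚ
one (suc _) = 0ℚ

-- y + j
y+_ : ℕ → Series
(y+ j) 0             = ℤ.+ j / 1
(y+ j) 1             = 1ℚ
(y+ j) (suc (suc _)) = 0ℚ

infixl 7 _⊛_

_⊛_ : Series → Series → Series
(a ⊛ b) k = sum {suc k} λ i → a (toℕ i) * b (k ∸ toℕ i)

-- The coefficients of 1/a of degrees k, k − 1, …, 0 (in this order), obtained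
-- by solving a ⊛ b = 1 for b degree by degree.
reciprocals : (a : Series) .{{_ : NonZero (a 0)}} → ∀ k → Vec ℚ (suc k)
reciprocals a zero    = 1/ (a 0) ∷ []
reciprocals a (suc k) =
  - (1/ (a 0) * sum {suc k} λ i → a (suc (toℕ i)) * lookup (reciprocals a k) i)
  ∷ reciprocals a k

reciprocal : (a : Series) .{{_ : NonZero (a 0)}} → Series
reciprocal a k = head (reciprocals a k)

lookup-reciprocals : (a : Series) .{{_ : NonZero (a 0)}} → ∀ k i →
  lookup (reciprocals a k) i ≡ reciprocal a (k ∸ toℕ i)
lookup-reciprocals a zero    zero    = refl
lookup-reciprocals a (suc k) zero    = refl
lookup-reciprocals a (suc k) (suc i) = lookup-reciprocals a k i

⊛-reciprocal : (a : Series) .{{_ : NonZero (a 0)}} → a ⊛ reciprocal a ≗ one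
⊛-reciprocal a zero    = trans (+-identityʳ _) (*-inverseʳ (a 0))
⊛-reciprocal a (suc k) = begin
  a 0 * - (1/ (a 0) * S) + T    ≡⟨ cong₂ _+_ (sym (neg-distribʳ-* (a 0) _)) T≡S ⟩
  - (a 0 * (1/ (a 0) * S)) + S  ≡⟨ cong (λ x → - x + S) (*-assoc (a 0) (1/ (a 0)) S) ⟨
  - (a 0 * 1/ (a 0) * S) + S    ≡⟨ cong (λ x → - (x * S) + S) (*-inverseʳ (a 0)) ⟩
  - (1ℚ * S) + S                ≡⟨ cong (λ x → - x + S) (*-identityˡ S) ⟩
  - S + S                       ≡⟨ +-inverseˡ S ⟩
  0ℚ                            ∎
  where
  open ≡-Reasoning
  S = sum {suc k} λ i → a (suc (toℕ i)) * lookup (reciprocals a k) i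
  T = sum {suc k} λ i → a (suc (toℕ i)) * reciprocal a (k ∸ toℕ i)
  T≡S : T ≡ S
  T≡S = sum-cong-≗ λ i → cong (a (suc (toℕ i)) *_) (sym (lookup-reciprocals a k i))

-- (y + 1)(y + 2)⋯(y + n)
∏[y+1⋯y+_] : ℕ → Series
∏[y+1⋯y+ zero  ] = one
∏[y+1⋯y+ suc n ] = ∏[y+1⋯y+ n ] ⊛ (y+ suc n)

∏-pos : ∀ n → Positive (∏[y+1⋯y+ n ] 0)
∏-pos zero    = _
∏-pos (suc n) = subst Positive (sym (+-identityʳ (∏[y+1⋯y+ n ] 0 * (ℤ.+ suc n / 1))))
  (pos*pos⇒pos (∏[y+1⋯y+ n ] 0) {{∏-pos n}} (ℤ.+ suc n / 1) {{normalize-pos (suc n) 1}})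

∏-nonZero : ∀ n → NonZero (∏[y+1⋯y+ n ] 0)
∏-nonZero n = pos⇒nonZero (∏[y+1⋯y+ n ] 0) {{∏-pos n}}

-- The Taylor expansion of (y)₋ₙ = 1/((y + 1)⋯(y + n)) at y = 0.  The denominator
-- does not vanish at 0, so this is its reciprocal as a power series.
⟨y⟩₋_ : ℕ → Series
⟨y⟩₋ n = reciprocal ∏[y+1⋯y+ n ] {{∏-nonZero n}}

-- s[- n , k ] is s(−n, k).
s[-_,_] : ℕ → ℕ → ℚ
s[- n , k ] = (⟨y⟩₋ n) k

-- Indices start at 0: `term i` is ρᵢ₊₁.
record LinearPartition : Set where
  field
    term           : ℕ → ℕ
    nonincreasing  : ∀ i → term (suc i) ≤ term i
    eventuallyZero : ∃[ N ] ∀ i → N ≤ i → term i ≡ 0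

  parts : List ℕ
  parts = filter nonZero? (applyUpTo term (proj₁ eventuallyZero))

  ℓ : ℕ
  ℓ = length parts

  π : ℕ
  π = product parts

  π-nonZero : ℕ.NonZero π
  π-nonZero = product≢0 (all-filter nonZero? (applyUpTo term (proj₁ eventuallyZero)))

  π⁻¹ : ℚ
  π⁻¹ = (ℤ.+ 1 / π) {{π-nonZero}}

open LinearPartition using (term; ℓ; π⁻¹)

-- Partitions are compared as sequences, ignoring the proof components (in
-- particular the choice of N in `eventuallyZero`).
linearPartitions[ℓ=_,ρ₁≤_] : ℕ → ℕ → Setoid 0ℓ 0ℓ
linearPartitions[ℓ= k ,ρ₁≤ n ] = record
  { Carrier       = Σ[ ρ ∈ LinearPartition ] (ℓ ρ ≡ k × term ρ 0 ≤ n)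
  ; _≈_           = _≗_ on (term ∘ proj₁)
  ; isEquivalence = On.isEquivalence (term ∘ proj₁) (Setoid.isEquivalence (ℕ →-setoid ℕ))
  }

∑ : ∀ {A : Set} → List A → (A → ℚ) → ℚ
∑ xs f = foldr _+_ 0ℚ (map f xs)

{-# OPTIONS --safe #-}

-- Sorting the partitions with k + 1 parts, all ≤ n + 1, by whether the largest
-- part is ≤ n or equal to n + 1 gives for the sum H(n,k) of their π(ρ)⁻¹ the
-- recurrence
--   H(n+1,k+1) = H(n,k+1) + H(n+1,k) / (n+1).
-- It says that the series c_n with coefficients (−1)ᵏ H(n,k) / n! satisfy
-- (y + n + 1) c_{n+1} = c_n.  As c_0 = 1, c_n is the reciprocal of
-- (y + 1)⋯(y + n).
module Submission where

open import Defs
open import Data.Nat.Base using (ℕ; _!)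
open import Data.Nat.Properties using (_!≢0)
open import Data.Integer.Base using (-1ℤ; _^_)
open import Data.Rational.Base using (_/_; _*_)
open import Data.Product.Base using (∃-syntax; _×_; proj₁)
open import Data.List.Relation.Unary.Enumerates.Setoid using (IsEnumeration)
open import Data.List.Relation.Unary.Unique.Setoid using (Unique)
open import Relation.Binary.PropositionalEquality using (_≡_)

open import Data.Fin.Base using (toℕ)
import Data.Integer.Base as ℤ
import Data.Integer.Properties as ℤ
open import Data.List.Base using (List; []; _∷_; _++_; length; map)
open import Data.List.Membership.Setoid.Properties using (∈-resp-≈; ∈-map⁺; ∈-map⁻; ∈-++⁺ˡ; ∈-++⁺ʳ)
open import Data.List.Properties using (filter-none)
open import Data.List.Relation.Binary.Disjoint.Setoid using (Disjoint)
open import Data.List.Relation.Unary.All using ([])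
open import Data.List.Relation.Unary.All.Properties using (applyUpTo⁺₂)
open import Data.List.Relation.Unary.AllPairs using ([]; _∷_)
open import Data.List.Relation.Unary.Any using (here)
import Data.List.Relation.Unary.Unique.Setoid.Properties as Unique
open import Data.Nat.Base as ℕ using (zero; suc; _∸_; _≤_; z≤n; s≤s)
import Data.Nat.Properties as ℕ
open import Data.Product.Base using (_,_)
open import Data.Rational.Base using (ℚ; 0ℚ; 1ℚ; 1/_; _+_; -_; NonZero)
open import Data.Rational.Properties using
  (+-0-commutativeMonoid; +-0-group; +-assoc; +-identityˡ; +-identityʳ; *-assoc; *-identityˡ;
   *-inverseˡ; *-zeroˡ; *-zeroʳ; *-distribˡ-+; /-cong;
   fromℚᵘ-cong; fromℚᵘ-toℚᵘ; toℚᵘ-fromℚᵘ; toℚᵘ-homo-*)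
open import Data.Rational.Solver using (module +-*-Solver)
open import Data.Rational.Unnormalised.Base using (mkℚᵘ; 1ℚᵘ; *≡*)
import Data.Rational.Unnormalised.Properties as ℚᵘ
open import Data.Sum.Base using (inj₁; inj₂)
open import Algebra.Properties.CommutativeMonoid.Sum +-0-commutativeMonoid using (sum-cong-≗)
open import Algebra.Properties.Group +-0-group using () renaming (∙-cancelʳ to +-cancelʳ)
open import Function.Base using (_∘_)
open import Relation.Binary.Bundles using (Setoid)
open import Relation.Binary.PropositionalEquality
  using (_≗_; refl; sym; trans; cong; cong₂; subst; module ≡-Reasoning)
open import Relation.Nullary.Negation using (contradiction)

open LinearPartition using (term; nonincreasing; eventuallyZero; ℓ; π; π-nonZero; π⁻¹)
open +-*-Solver using (solve; _:=_; _:+_; _:*_; :-_; con)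
open ≡-Reasoning

-- Power series

⊛-cong : ∀ {a a′ b b′} → a ≗ a′ → b ≗ b′ → a ⊛ b ≗ a′ ⊛ b′
⊛-cong a≗a′ b≗b′ k = sum-cong-≗ {suc k} λ i → cong₂ _*_ (a≗a′ (toℕ i)) (b≗b′ (k ∸ toℕ i))

-- The factors `b (k ∸ i)` reach degree `k` at most. This locality is what lets `⊛-cancelˡ` compare
-- coefficients by strong induction.
⊛-congʳ-≤ : ∀ a {b b′} k → (∀ j → j ≤ k → b j ≡ b′ j) → (a ⊛ b) k ≡ (a ⊛ b′) k
⊛-congʳ-≤ a k b≡b′ =
  sum-cong-≗ {suc k} λ i → cong (a (toℕ i) *_) (b≡b′ (k ∸ toℕ i) (ℕ.m∸n≤m k (toℕ i)))

⊛-zeroˡ : ∀ b → (λ _ → 0ℚ) ⊛ b ≗ λ _ → 0ℚ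
⊛-zeroˡ b zero    = trans (+-identityʳ _) (*-zeroˡ (b 0))
⊛-zeroˡ b (suc k) = cong₂ _+_ (*-zeroˡ (b (suc k))) (⊛-zeroˡ b k)

⊛-identityˡ : ∀ b → one ⊛ b ≗ b
⊛-identityˡ b zero    = trans (+-identityʳ _) (*-identityˡ (b 0))
⊛-identityˡ b (suc k) =
  trans (cong₂ _+_ (*-identityˡ (b (suc k))) (⊛-zeroˡ b k)) (+-identityʳ (b (suc k)))

-- The left factor has the shape of a shifted product: `(a ⊛ b) (suc j)` unfolds to
-- `a 0 * b (suc j) + ((a ∘ suc) ⊛ b) j`. This is the form that `⊛-assoc` meets.
⊛-distribˡ : ∀ x a b c → (λ j → x * a j + b j) ⊛ c ≗ λ k → x * (a ⊛ c) k + (b ⊛ c) k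
⊛-distribˡ x a b c zero =
  solve 4 (λ x a b c → (x :* a :+ b) :* c :+ con 0ℚ :=
                       x :* (a :* c :+ con 0ℚ) :+ (b :* c :+ con 0ℚ))
    refl x (a 0) (b 0) (c 0)
⊛-distribˡ x a b c (suc k) = begin
  (x * a 0 + b 0) * c (suc k) + ((λ j → x * a (suc j) + b (suc j)) ⊛ c) k
    ≡⟨ cong ((x * a 0 + b 0) * c (suc k) +_) (⊛-distribˡ x (a ∘ suc) (b ∘ suc) c k) ⟩
  (x * a 0 + b 0) * c (suc k) + (x * ((a ∘ suc) ⊛ c) k + ((b ∘ suc) ⊛ c) k)
    ≡⟨ solve 6 (λ x a b c s t → (x :* a :+ b) :* c :+ (x :* s :+ t) :=
                                x :* (a :* c :+ s) :+ (b :* c :+ t))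
         refl x (a 0) (b 0) (c (suc k)) (((a ∘ suc) ⊛ c) k) (((b ∘ suc) ⊛ c) k) ⟩
  x * (a ⊛ c) (suc k) + (b ⊛ c) (suc k) ∎

-- Induction on the degree with `a` left general: splitting off the constant term of `a` leaves the
-- same claim for `a ∘ suc` one degree lower.
⊛-assoc : ∀ a b c → (a ⊛ b) ⊛ c ≗ a ⊛ (b ⊛ c)
⊛-assoc a b c zero =
  solve 3 (λ a b c → (a :* b :+ con 0ℚ) :* c :+ con 0ℚ := a :* (b :* c :+ con 0ℚ) :+ con 0ℚ)
    refl (a 0) (b 0) (c 0)
⊛-assoc a b c (suc k) = begin
  (a 0 * b 0 + 0ℚ) * c (suc k) + ((λ j → a 0 * b (suc j) + ((a ∘ suc) ⊛ b) j) ⊛ c) k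
    ≡⟨ cong ((a 0 * b 0 + 0ℚ) * c (suc k) +_) (⊛-distribˡ (a 0) (b ∘ suc) ((a ∘ suc) ⊛ b) c k) ⟩
  (a 0 * b 0 + 0ℚ) * c (suc k) + (a 0 * ((b ∘ suc) ⊛ c) k + (((a ∘ suc) ⊛ b) ⊛ c) k)
    ≡⟨ cong (λ s → (a 0 * b 0 + 0ℚ) * c (suc k) + (a 0 * ((b ∘ suc) ⊛ c) k + s))
         (⊛-assoc (a ∘ suc) b c k) ⟩
  (a 0 * b 0 + 0ℚ) * c (suc k) + (a 0 * ((b ∘ suc) ⊛ c) k + ((a ∘ suc) ⊛ (b ⊛ c)) k)
    ≡⟨ solve 5 (λ a b c s t → (a :* b :+ con 0ℚ) :* c :+ (a :* s :+ t) :=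
                              a :* (b :* c :+ s) :+ t)
         refl (a 0) (b 0) (c (suc k)) (((b ∘ suc) ⊛ c) k) (((a ∘ suc) ⊛ (b ⊛ c)) k) ⟩
  (a ⊛ (b ⊛ c)) (suc k) ∎

*-cancelˡ : ∀ x .{{_ : NonZero x}} {y z} → x * y ≡ x * z → y ≡ z
*-cancelˡ x {y} {z} xy≡xz = begin
  y              ≡⟨ *-identityˡ y ⟨
  1ℚ * y         ≡⟨ cong (_* y) (*-inverseˡ x) ⟨
  1/ x * x * y   ≡⟨ *-assoc (1/ x) x y ⟩
  1/ x * (x * y) ≡⟨ cong (1/ x *_) xy≡xz ⟩
  1/ x * (x * z) ≡⟨ *-assoc (1/ x) x z ⟨
  1/ x * x * z   ≡⟨ cong (_* z) (*-inverseˡ x) ⟩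
  1ℚ * z         ≡⟨ *-identityˡ z ⟩
  z              ∎

-- Each coefficient of the product involves its top unknown only through multiplication by the
-- invertible `a 0`, so the unknowns are determined degree by degree.
⊛-cancelˡ : ∀ a .{{_ : NonZero (a 0)}} {b c} → a ⊛ b ≗ a ⊛ c → b ≗ c
⊛-cancelˡ a {b} {c} ab≗ac k = agree k k ℕ.≤-refl
  where
  -- The bound `k` drops by one at each call, which makes strong induction on `j` structural.
  agree : ∀ k j → j ≤ k → b j ≡ c j
  agree _       zero    _         =
    *-cancelˡ (a 0) (+-cancelʳ 0ℚ (a 0 * b 0) (a 0 * c 0) (ab≗ac 0))
  agree (suc k) (suc j) (s≤s j≤k) =
    -- The remainders of the two convolutions involve only degrees up to `j`, so they agree and
    -- cancel; then `a 0` cancels.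
    *-cancelˡ (a 0) (+-cancelʳ _ _ _ (trans (ab≗ac (suc j)) (cong (a 0 * c (suc j) +_)
      (sym (⊛-congʳ-≤ (a ∘ suc) j λ i i≤j → agree k i (ℕ.≤-trans i≤j j≤k))))))

reciprocal-unique : ∀ a .{{_ : NonZero (a 0)}} {b} → a ⊛ b ≗ one → reciprocal a ≗ b
reciprocal-unique a ab≗one = ⊛-cancelˡ a λ k → trans (⊛-reciprocal a k) (sym (ab≗one k))

y+-⊛-suc : ∀ j b k → ((y+ j) ⊛ b) (suc k) ≡ (ℤ.+ j / 1) * b (suc k) + b k
y+-⊛-suc j b k = cong ((ℤ.+ j / 1) * b (suc k) +_)
  (trans (⊛-cong {b = b} tail≗one (λ _ → refl) k) (⊛-identityˡ b k))
  where
  tail≗one : (y+ j) ∘ suc ≗ one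
  tail≗one zero    = refl
  tail≗one (suc _) = refl

-- Fractions

-- `_/_` reduces to lowest terms, so the product is computed among unnormalised fractions, where
-- numerators and denominators simply multiply.
/-* : ∀ i j m n .{{_ : ℕ.NonZero m}} .{{_ : ℕ.NonZero n}} →
  i / m * (j / n) ≡ ((i ℤ.* j) / (m ℕ.* n)) {{ℕ.m*n≢0 m n}}
/-* i j (suc m) (suc n) = trans (sym (fromℚᵘ-toℚᵘ (i / suc m * (j / suc n))))
  (fromℚᵘ-cong (ℚᵘ.≃-trans (toℚᵘ-homo-* (i / suc m) (j / suc n))
    (ℚᵘ.*-cong (toℚᵘ-fromℚᵘ (mkℚᵘ i m)) (toℚᵘ-fromℚᵘ (mkℚᵘ j n)))))

n*1/n≡1 : ∀ n .{{_ : ℕ.NonZero n}} → (ℤ.+ n / 1) * (ℤ.+ 1 / n) ≡ 1ℚ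
n*1/n≡1 (suc n) = trans (/-* (ℤ.+ suc n) (ℤ.+ 1) 1 (suc n))
  (fromℚᵘ-cong {mkℚᵘ (ℤ.+ suc n ℤ.* ℤ.+ 1) (n ℕ.+ 0)} {1ℚᵘ}
    (*≡* (trans (ℤ.*-identityʳ _) (trans (ℤ.*-comm (ℤ.+ suc n) (ℤ.+ 1))
      (cong (ℤ.+ 1 ℤ.*_) (cong (ℤ.+_ ∘ suc) (sym (ℕ.+-identityʳ n))))))))

-1^_/_! : ℕ → ℕ → ℚ
-1^ k / n ! = ((-1ℤ ^ k) / (n !)) {{n !≢0}}

-1^suc/! : ∀ k n → -1^ suc k / n ! ≡ - (-1^ k / n !)
-1^suc/! k n = begin
  -1^ suc k / n !
    -- The denominator is written as `1 ℕ.* n !` so that `/-*` can split off the factor `-1ℤ / 1`.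
    ≡⟨ /-cong {p₁ = -1ℤ ^ suc k} {{n !≢0}} {{ℕ.m*n≢0 1 (n !) {{_}} {{n !≢0}}}} refl (sym (ℕ.*-identityˡ (n !))) ⟩
  ((-1ℤ ℤ.* (-1ℤ ^ k)) / (1 ℕ.* n !)) {{ℕ.m*n≢0 1 (n !) {{_}} {{n !≢0}}}}
    ≡⟨ /-* -1ℤ (-1ℤ ^ k) 1 (n !) {{_}} {{n !≢0}} ⟨
  - 1ℚ * (-1^ k / n !)
    ≡⟨ solve 1 (λ x → con (- 1ℚ) :* x := :- x) refl (-1^ k / n !) ⟩
  - (-1^ k / n !) ∎

-1^/suc! : ∀ k n → -1^ k / suc n ! ≡ (ℤ.+ 1 / suc n) * (-1^ k / n !)
-1^/suc! k n = sym (trans (/-* (ℤ.+ 1) (-1ℤ ^ k) (suc n) (n !) {{_}} {{n !≢0}})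
  (cong (λ i → (i / (suc n !)) {{suc n !≢0}}) (ℤ.*-identityˡ (-1ℤ ^ k))))

-- Linear partitions

[]ₚ : LinearPartition
[]ₚ = record
  { term           = λ _ → 0
  ; nonincreasing  = λ _ → z≤n
  ; eventuallyZero = 0 , λ _ _ → refl
  }

consₚ : ∀ m ρ → term ρ 0 ≤ m → LinearPartition
consₚ m ρ ρ₁≤m = record
  { term           = λ { zero → m ; (suc i) → term ρ i }
  ; nonincreasing  = λ { zero → ρ₁≤m ; (suc i) → nonincreasing ρ i }
  ; eventuallyZero = let N , ≡0 = eventuallyZero ρ in
                     suc N , λ { (suc i) (s≤s N≤i) → ≡0 i N≤i }
  }

tailₚ : LinearPartition → LinearPartition
tailₚ ρ = record
  { term           = term ρ ∘ suc
  ; nonincreasing  = nonincreasing ρ ∘ suc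
  ; eventuallyZero = let N , ≡0 = eventuallyZero ρ in
                     -- Truncated subtraction also covers `N = 0`, since `N ≤ 1 + (N ∸ 1)` always
                     -- holds.
                     N ∸ 1 , λ i N-1≤i → ≡0 (suc i) (ℕ.≤-trans (ℕ.m≤n+m∸n N 1) (s≤s N-1≤i))
  }

-- `parts` depends on the stored bound. A nonzero first term excludes the bound 0; for `suc N` the
-- filter keeps that term and then runs over the tail with bound `N`.
ℓ-tailₚ : ∀ ρ {m} → term ρ 0 ≡ suc m → ℓ ρ ≡ suc (ℓ (tailₚ ρ))
ℓ-tailₚ ρ ρ₁≡1+m with eventuallyZero ρ
... | zero  , ≡0 = contradiction (trans (sym (≡0 0 z≤n)) ρ₁≡1+m) λ ()
... | suc N , ≡0 rewrite ρ₁≡1+m = refl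

ℓ≡0⇒ρ₁≡0 : ∀ ρ → ℓ ρ ≡ 0 → term ρ 0 ≡ 0
ℓ≡0⇒ρ₁≡0 ρ ℓ≡0 with term ρ 0 in ρ₁≡
... | zero  = refl
... | suc m = contradiction (trans (sym (ℓ-tailₚ ρ ρ₁≡)) ℓ≡0) λ ()

ρ₁≡0⇒≗0 : ∀ ρ → term ρ 0 ≡ 0 → term ρ ≗ λ _ → 0
ρ₁≡0⇒≗0 ρ ρ₁≡0 zero    = ρ₁≡0
ρ₁≡0⇒≗0 ρ ρ₁≡0 (suc i) =
  ℕ.n≤0⇒n≡0 (subst (term ρ (suc i) ≤_) (ρ₁≡0⇒≗0 ρ ρ₁≡0 i) (nonincreasing ρ i))

ρ₁≡0⇒ℓ≡0 : ∀ ρ → term ρ 0 ≡ 0 → ℓ ρ ≡ 0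
ρ₁≡0⇒ℓ≡0 ρ ρ₁≡0 = cong length (filter-none ℕ.nonZero?
  (applyUpTo⁺₂ (term ρ) (proj₁ (eventuallyZero ρ)) λ i nz →
    ℕ.≢-nonZero⁻¹ (term ρ i) {{nz}} (ρ₁≡0⇒≗0 ρ ρ₁≡0 i)))

-- The bound stored by `consₚ` is one more than that of `ρ`, so its list of parts computes to
-- `suc m` followed by the parts of `ρ`.
π⁻¹-consₚ : ∀ m ρ ρ₁≤ → π⁻¹ (consₚ (suc m) ρ ρ₁≤) ≡ (ℤ.+ 1 / suc m) * π⁻¹ ρ
π⁻¹-consₚ m ρ _ = sym (/-* (ℤ.+ 1) (ℤ.+ 1) (suc m) (π ρ) {{_}} {{π-nonZero ρ}})

-- Enumeration of the partitions with k parts, all at most n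

Partition : ℕ → ℕ → Set
Partition k n = Setoid.Carrier linearPartitions[ℓ= k ,ρ₁≤ n ]

empty : ∀ n → Partition 0 n
empty n = []ₚ , refl , z≤n

weaken : ∀ {n k} → Partition k n → Partition k (suc n)
weaken (ρ , ℓ≡k , ρ₁≤n) = ρ , ℓ≡k , ℕ.m≤n⇒m≤1+n ρ₁≤n

cons : ∀ {n k} → Partition k (suc n) → Partition (suc k) (suc n)
cons {n} (ρ , ℓ≡k , ρ₁≤) = consₚ (suc n) ρ ρ₁≤ , cong suc ℓ≡k , ℕ.≤-refl

-- The call under `cons` keeps the bound `suc n`, because the largest part may be repeated.
partitions : ∀ n k → List (Partition k n)
partitions n       zero    = empty n ∷ []
partitions zero    (suc k) = []
partitions (suc n) (suc k) =
  map weaken (partitions n (suc k)) ++ map cons (partitions (suc n) k)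

partitions-enumerates : ∀ n k → IsEnumeration linearPartitions[ℓ= k ,ρ₁≤ n ] (partitions n k)
partitions-enumerates n zero (ρ , ℓ≡0 , _) = here (ρ₁≡0⇒≗0 ρ (ℓ≡0⇒ρ₁≡0 ρ ℓ≡0))
partitions-enumerates zero (suc k) (ρ , ℓ≡1+k , ρ₁≤0) =
  contradiction (trans (sym ℓ≡1+k) (ρ₁≡0⇒ℓ≡0 ρ (ℕ.n≤0⇒n≡0 ρ₁≤0))) λ ()
partitions-enumerates (suc n) (suc k) x@(ρ , ℓ≡1+k , ρ₁≤1+n) with ℕ.m≤n⇒m<n∨m≡n ρ₁≤1+n
... | inj₁ (s≤s ρ₁≤n) =
  ∈-++⁺ˡ S {x} (∈-map⁺ linearPartitions[ℓ= suc k ,ρ₁≤ n ] S {weaken} (λ ≈ → ≈)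
    {y} (partitions-enumerates n (suc k) y))
  where
  S = linearPartitions[ℓ= suc k ,ρ₁≤ suc n ]
  y : Partition (suc k) n
  y = ρ , ℓ≡1+k , ρ₁≤n
... | inj₂ ρ₁≡1+n =
  ∈-++⁺ʳ S {x} (map weaken (partitions n (suc k)))
    -- Restoring the largest part to the tail gives back `ρ` only up to pointwise equality: the
    -- first term is now literally `suc n`.
    (∈-resp-≈ S {_} {cons y} {x} (λ { zero → sym ρ₁≡1+n ; (suc i) → refl })
      (∈-map⁺ linearPartitions[ℓ= k ,ρ₁≤ suc n ] S {cons}
        (λ { ≈ zero → refl ; ≈ (suc i) → ≈ i }) {y} (partitions-enumerates (suc n) k y)))
  where
  S = linearPartitions[ℓ= suc k ,ρ₁≤ suc n ]
  y : Partition k (suc n)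
  y = tailₚ ρ , ℕ.suc-injective (trans (sym (ℓ-tailₚ ρ ρ₁≡1+n)) ℓ≡1+k)
              , ℕ.≤-trans (nonincreasing ρ 0) ρ₁≤1+n

partitions-unique : ∀ n k → Unique linearPartitions[ℓ= k ,ρ₁≤ n ] (partitions n k)
partitions-unique n       zero    = [] ∷ []
partitions-unique zero    (suc k) = []
partitions-unique (suc n) (suc k) = Unique.++⁺ S
  (Unique.map⁺ S₁ S (λ ≈ → ≈) (partitions-unique n (suc k)))
  (Unique.map⁺ S₂ S (λ ≈ → ≈ ∘ suc) (partitions-unique (suc n) k))
  λ {x} → disjoint {x}
  where
  S  = linearPartitions[ℓ= suc k ,ρ₁≤ suc n ]
  S₁ = linearPartitions[ℓ= suc k ,ρ₁≤ n ]
  S₂ = linearPartitions[ℓ= k ,ρ₁≤ suc n ]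
  disjoint : Disjoint S (map weaken (partitions n (suc k))) (map cons (partitions (suc n) k))
  disjoint {x} (∈weaken , ∈cons) =
    let (_ , _ , ρ₁≤n) , _ , ≈weaken = ∈-map⁻ S₁ S {x} ∈weaken
        _              , _ , ≈cons   = ∈-map⁻ S₂ S {x} ∈cons
    -- A common element would have a first term both at most `n` and equal to `suc n`.
    in ℕ.1+n≰n (subst (_≤ n) (trans (sym (≈weaken 0)) (≈cons 0)) ρ₁≤n)

-- Sums of reciprocal products and their recurrence

∑-++ : ∀ {A : Set} xs ys (f : A → ℚ) → ∑ (xs ++ ys) f ≡ ∑ xs f + ∑ ys f
∑-++ []       ys f = sym (+-identityˡ _)
∑-++ (x ∷ xs) ys f = trans (cong (f x +_) (∑-++ xs ys f)) (sym (+-assoc (f x) _ _))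

∑-map : ∀ {A B : Set} {g : A → B} {f : A → ℚ} {h : B → ℚ} c → (∀ x → h (g x) ≡ c * f x) →
  ∀ xs → ∑ (map g xs) h ≡ c * ∑ xs f
∑-map         c hg≡cf []       = sym (*-zeroʳ c)
∑-map {f = f} c hg≡cf (x ∷ xs) =
  trans (cong₂ _+_ (hg≡cf x) (∑-map c hg≡cf xs)) (sym (*-distribˡ-+ c (f x) (∑ xs f)))

∑π⁻¹ : ℕ → ℕ → ℚ
∑π⁻¹ n k = ∑ (partitions n k) λ ρ → π⁻¹ (proj₁ ρ)

∑π⁻¹-suc-suc : ∀ n k →
  ∑π⁻¹ (suc n) (suc k) ≡ ∑π⁻¹ n (suc k) + (ℤ.+ 1 / suc n) * ∑π⁻¹ (suc n) k
∑π⁻¹-suc-suc n k = begin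
  ∑π⁻¹ (suc n) (suc k)
    ≡⟨ ∑-++ (map weaken (partitions n (suc k))) (map cons (partitions (suc n) k)) _ ⟩
  ∑ (map weaken (partitions n (suc k))) _ + ∑ (map cons (partitions (suc n) k)) _
    ≡⟨ cong₂ _+_
         (∑-map {g = weaken} 1ℚ (λ _ → sym (*-identityˡ _)) (partitions n (suc k)))
         (∑-map {g = cons} (ℤ.+ 1 / suc n) (λ (ρ , _ , ρ₁≤) → π⁻¹-consₚ n ρ ρ₁≤)
           (partitions (suc n) k)) ⟩
  1ℚ * ∑π⁻¹ n (suc k) + (ℤ.+ 1 / suc n) * ∑π⁻¹ (suc n) k
    ≡⟨ cong (_+ (ℤ.+ 1 / suc n) * ∑π⁻¹ (suc n) k) (*-identityˡ (∑π⁻¹ n (suc k))) ⟩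
  ∑π⁻¹ n (suc k) + (ℤ.+ 1 / suc n) * ∑π⁻¹ (suc n) k ∎

-- The series of partition sums as a reciprocal

partitionSeries : ℕ → Series
partitionSeries n k = (-1^ k / n !) * ∑π⁻¹ n k

-- In degree `suc k` the recurrence splits the leading term in two. The share of `∑π⁻¹ (suc n) k`
-- cancels against the term from degree `k`, whose sign is opposite.
partitionSeries-step : ∀ n → (y+ suc n) ⊛ partitionSeries (suc n) ≗ partitionSeries n
partitionSeries-step n zero = begin
  N * ((-1^ 0 / suc n !) * 1ℚ) + 0ℚ  ≡⟨ cong (λ x → N * (x * 1ℚ) + 0ℚ) (-1^/suc! 0 n) ⟩
  N * (u * e * 1ℚ) + 0ℚ              ≡⟨ solve 3 (λ N u e → N :* (u :* e :* con 1ℚ) :+ con 0ℚ :=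
                                                           N :* u :* (e :* con 1ℚ)) refl N u e ⟩
  N * u * (e * 1ℚ)                   ≡⟨ cong (_* (e * 1ℚ)) (n*1/n≡1 (suc n)) ⟩
  1ℚ * (e * 1ℚ)                      ≡⟨ *-identityˡ (e * 1ℚ) ⟩
  e * 1ℚ                             ∎
  where
  N = ℤ.+ suc n / 1
  u = ℤ.+ 1 / suc n
  e = -1^ 0 / n !
partitionSeries-step n (suc k) = begin
  ((y+ suc n) ⊛ partitionSeries (suc n)) (suc k)
    ≡⟨ y+-⊛-suc (suc n) (partitionSeries (suc n)) k ⟩
  N * ((-1^ suc k / suc n !) * ∑π⁻¹ (suc n) (suc k)) + (-1^ k / suc n !) * H′
    ≡⟨ cong₂ (λ x y → N * (x * y) + (-1^ k / suc n !) * H′)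
         (-1^suc/! k (suc n)) (∑π⁻¹-suc-suc n k) ⟩
  N * (- (-1^ k / suc n !) * (H + u * H′)) + (-1^ k / suc n !) * H′
    ≡⟨ cong (λ x → N * (- x * (H + u * H′)) + x * H′) (-1^/suc! k n) ⟩
  N * (- (u * e) * (H + u * H′)) + u * e * H′
    -- The product `N * u` is isolated because `N * u ≡ 1ℚ` is not a ring identity and must be
    -- applied separately.
    ≡⟨ solve 5 (λ N u e H H′ → N :* (:- (u :* e) :* (H :+ u :* H′)) :+ u :* e :* H′ :=
                               N :* u :* (:- (e :* (H :+ u :* H′))) :+ u :* e :* H′)
         refl N u e H H′ ⟩
  N * u * - (e * (H + u * H′)) + u * e * H′
    ≡⟨ cong (λ x → x * - (e * (H + u * H′)) + u * e * H′) (n*1/n≡1 (suc n)) ⟩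
  1ℚ * - (e * (H + u * H′)) + u * e * H′
    ≡⟨ solve 4 (λ u e H H′ → con 1ℚ :* (:- (e :* (H :+ u :* H′))) :+ u :* e :* H′ :=
                             (:- e) :* H)
         refl u e H H′ ⟩
  - e * H
    ≡⟨ cong (_* H) (-1^suc/! k n) ⟨
  (-1^ suc k / n !) * H ∎
  where
  N  = ℤ.+ suc n / 1
  u  = ℤ.+ 1 / suc n
  e  = -1^ k / n !
  H  = ∑π⁻¹ n (suc k)
  H′ = ∑π⁻¹ (suc n) k

-- Associativity moves the last factor `y+ suc n` onto the partition series, where
-- `partitionSeries-step` absorbs it and lowers `n`.
∏-⊛-partitionSeries : ∀ n → ∏[y+1⋯y+ n ] ⊛ partitionSeries n ≗ one
∏-⊛-partitionSeries zero k = trans (⊛-identityˡ (partitionSeries 0) k) (partitionSeries-0 k)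
  where
  partitionSeries-0 : partitionSeries 0 ≗ one
  -- With no part allowed, the empty partition contributes 1 in degree 0, and the sums in higher
  -- degrees are empty.
  partitionSeries-0 zero    = refl
  partitionSeries-0 (suc k) = *-zeroʳ (-1^ suc k / 0 !)
∏-⊛-partitionSeries (suc n) k = begin
  (∏[y+1⋯y+ n ] ⊛ (y+ suc n) ⊛ partitionSeries (suc n)) k
    ≡⟨ ⊛-assoc ∏[y+1⋯y+ n ] (y+ suc n) (partitionSeries (suc n)) k ⟩
  (∏[y+1⋯y+ n ] ⊛ ((y+ suc n) ⊛ partitionSeries (suc n))) k
    ≡⟨ ⊛-cong {∏[y+1⋯y+ n ]} (λ _ → refl) (partitionSeries-step n) k ⟩
  (∏[y+1⋯y+ n ] ⊛ partitionSeries n) k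
    ≡⟨ ∏-⊛-partitionSeries n k ⟩
  one k ∎

-- The finite sum is expressed through a list that meets every partition in the index set, and by
-- uniqueness meets it only once.
proposition2p1 : ∀ (n k : ℕ) →
    ∃[ ρs ] IsEnumeration linearPartitions[ℓ= k ,ρ₁≤ n ] ρs
    × Unique linearPartitions[ℓ= k ,ρ₁≤ n ] ρs
    × s[- n , k ] ≡ ((-1ℤ ^ k) / (n !)) {{n !≢0}} * ∑ ρs (λ ρ → LinearPartition.π⁻¹ (proj₁ ρ))
proposition2p1 n k =
  partitions n k , partitions-enumerates n k , partitions-unique n k ,
  reciprocal-unique ∏[y+1⋯y+ n ] {{∏-nonZero n}} (∏-⊛-partitionSeries n) k
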